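{- For every word $w$ over a finite alphabet, the algorithm $\mathrm{GetAnAttractor}$ applied to the suffix automaton (DAWG) $\mathcal{S}(w)$ of $w$ outputs a word attractor of $w$.
   Context: Let $w=w_1w_2\cdots w_n$ be a finite word over a finite alphabet, $n\ge 0$, $|w|=n$. Positions on $w$ are the elements of $\{1,\dots,n\}$. A factor of $w$ is a word $w_{[i,j]}=w_i\cdots w_j$ (the empty word if $j<i$). An occurrence of a non-empty factor $u$ in $w$ is a pair $(i,j)$, $1\le i\le j\le n$, with $u=w_{[i,j]}$; $j$ is its ending position. A set $P\subseteq\{1,\dots,n\}$ is a word attractor of $w$ if every non-empty factor $u$ of $w$ has an occurrence $(i,j)$ in $w$ with $i\le t\le j$ for some $t\in P$. Suffix automaton (DAWG): the states of $\mathcal{S}(w)$ are the equivalence classes of the factors of $w$ (including the empty word), where two factors are equivalent iff they have the same set of ending positions in $w$ (the empty word having ending positions $0,1,\dots,n$). $|\mathcal{S}(w)|$ is the number of states. The initial state $I$ is the class of the empty word. For a factor $u$, $\delta(I,u)$ is the class of $u$. For a state $q$, $\ell[q]$ is the minimum length of the factors in $q$ and $\mathrm{POS}[q]$ is the smallest ending position of any factor in $q$ (so $\mathrm{POS}[I]=0$). Suffix links: for a state $q\neq I$ and any factor $x\in q$, $F[q]$ is the class of the longest suffix of $x$ that does not belong to $q$ (independent of the choice of $x$). The table of prefix states is $T[j]=\delta(I,w_{[1,j]})$ for $1\le j\le n$. Algorithm $\mathrm{GetAnAttractor}(\mathcal{S}(w))$: Initialization: for all states $q$ set $d[q]\leftarrow+\infty$;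 set $P\leftarrow\emptyset$, $\mathit{checked}\leftarrow\{I\}$, $j\leftarrow|w|$. While $j>0$ do: (a) [stacking] set $i\leftarrow j$, $k\leftarrow 1$; while $k\le i$ do: set $q\leftarrow T[i]$; while $\mathrm{POS}[q]=i$ do { if $d[q]\ge\ell[q]$ then set $k\leftarrow\max\{k,\,i-\ell[q]+1\}$; set $q\leftarrow F[q]$ }; set $i\leftarrow i-1$. (b) [adding] set $P\leftarrow P\cup\{k\}$. (c) [updating] for $i=k,k+1,\dots,j$ in this order do: set $e\leftarrow i-k$, $q\leftarrow T[i]$; while $q\neq I$ and $e<d[q]$ do { set $d[q]\leftarrow e$; if $d[q]<\ell[q]$ then { set $\mathit{checked}\leftarrow\mathit{checked}\cup\{q\}$; if $|\mathit{checked}|=|\mathcal{S}(w)|$ then return $P$ and stop }; set $q\leftarrow F[q]$ }. (d) set $j\leftarrow k-1$. -}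

module Defs where

open import Data.Bool using (if_then_else_)
open import Data.Fin using (Fin)
import Data.Fin.Properties as Fin
open import Data.List using
  (List; []; _∷_; length; map; take; drop; filter; deduplicate; concatMap;
   cartesianProductWith; upTo; applyUpTo)
open import Data.List.Extrema.Nat using (min)
open import Data.List.Membership.Propositional using (_∈_)
import Data.List.Membership.DecPropositional as DecMembership
import Data.List.Properties as List
open import Data.List.Relation.Unary.All using (All)
open import Data.Nat using (ℕ; suc; _+_; _∸_; _⊔_; _≤_; _<_; _>_; s≤s; s≤s⁻¹; _≤?_; _≟_)
open import Data.Nat.Properties using (anyUpTo?)
open import Data.Product using (_×_; _,_; ∃; ∃₂)
open import Relation.Binary.Construct.Add.Supremum.NonStrict _≤_ using (_≤⁺_)
open import Relation.Binary.Construct.Add.Supremum.Strict _<_ using (_<⁺_)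
open import Relation.Binary.Definitions using (DecidableEquality)
open import Relation.Binary.PropositionalEquality using (_≡_; _≢_)
open import Relation.Nullary using (¬_; Dec; does)
open import Relation.Nullary.Construct.Add.Supremum using (_⁺; [_]; ⊤⁺)
open import Relation.Nullary.Decidable using (map′; _×-dec_)

Word : ℕ → Set
Word σ = List (Fin σ)

_≟ʷ_ : ∀ {σ} → DecidableEquality (Word σ)
_≟ʷ_ = List.≡-dec Fin._≟_

module _ {σ : ℕ} (w : Word σ) where

  private
    n : ℕ
    n = length w

  -- w_i ⋯ w_j with positions counted from 1; the empty word if j < i.
  -- Only meaningful for 1 ≤ i and j ≤ n.
  factor : ℕ → ℕ → Word σ
  factor i j = take (suc j ∸ i) (drop (i ∸ 1) w)

  IsFactor : Word σ → Set
  IsFactor u = ∃₂ λ i j → 1 ≤ i × j ≤ n × u ≡ factor i j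

  IsOccurrence : Word σ → ℕ → ℕ → Set
  IsOccurrence u i j = 1 ≤ i × i ≤ j × j ≤ n × u ≡ factor i j

  -- A finite set of positions is given by a list of its elements.
  IsAttractor : List ℕ → Set
  IsAttractor P =
    All (λ t → 1 ≤ t × t ≤ n) P ×
    (∀ u → u ≢ [] → IsFactor u →
      ∃₂ λ i j → IsOccurrence u i j × ∃ λ t → t ∈ P × i ≤ t × t ≤ j)

  IsEndPos : Word σ → ℕ → Set
  IsEndPos []        j = j ≤ n
  IsEndPos u@(_ ∷ _) j = ∃ λ i → IsOccurrence u i j

  isEndPos? : ∀ u j → Dec (IsEndPos u j)
  isEndPos? []        j = j ≤? n
  isEndPos? u@(_ ∷ _) j =
    map′ (λ (i , _ , occ) → i , occ)
         (λ (i , 1≤i , i≤j , rest) → i , s≤s i≤j , 1≤i , i≤j , rest)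
         (anyUpTo? (λ i → 1 ≤? i ×-dec i ≤? j ×-dec j ≤? n ×-dec u ≟ʷ factor i j) (suc j))

  -- In increasing order, so that two words have the same set of ending
  -- positions iff these lists are equal.
  endPositions : Word σ → List ℕ
  endPositions u = filter (isEndPos? u) (upTo (suc n))

  factors : List (Word σ)
  factors = deduplicate _≟ʷ_ (cartesianProductWith factor (applyUpTo suc (suc n)) (upTo (suc n)))

  -- A state is an equivalence class of factors, given by the list of its
  -- members in the order in which they appear in `factors`. Hence two factors
  -- are equivalent iff their classes are propositionally equal. Lists that are
  -- not of the form `class u` for a factor u are not states of the automaton.
  State : Set
  State = List (Word σ)

  _≟ˢ_ : DecidableEquality State
  _≟ˢ_ = List.≡-dec _≟ʷ_

  class : Word σ → State
  class u = filter (λ v → List.≡-dec _≟_ (endPositions u) (endPositions v)) factors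

  card : List State → ℕ
  card qs = length (deduplicate _≟ˢ_ qs)

  -- |S(w)|
  size : ℕ
  size = card (map class factors)

  I : State
  I = class []

  -- In ℓ and POS the first argument of `min` is only an upper bound: lengths of
  -- factors and ending positions never exceed n.
  ℓ : State → ℕ
  ℓ q = min n (map length q)

  POS : State → ℕ
  POS q = min n (concatMap endPositions q)

  open DecMembership (_≟ʷ_ {σ}) using (_∈?_)

  longestSuffixOutside : State → Word σ → Word σ
  longestSuffixOutside q []        = []
  longestSuffixOutside q u@(_ ∷ v) = if does (u ∈? q) then longestSuffixOutside q v else u

  -- The suffix link, computed from one member of q. It is meaningless on I and on
  -- [], which is not a state; the algorithm never follows it there.
  F : State → State
  F []        = I
  F q@(x ∷ _) = class (longestSuffixOutside q x)

  -- Meaningful for 1 ≤ j ≤ n.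
  T : ℕ → State
  T j = class (factor 1 j)

  record Store : Set where
    constructor store
    field
      P       : List ℕ
      checked : List State
      d       : State → ℕ ⁺

  open Store public

  initial : Store
  initial = store [] (I ∷ []) (λ _ → ⊤⁺)

  _∪P_ : Store → ℕ → Store
  s ∪P k = record s { P = k ∷ P s }

  _∪checked_ : Store → State → Store
  s ∪checked q = record s { checked = q ∷ checked s }

  _[d_≔_] : Store → State → ℕ → Store
  s [d q ≔ e ] = record s { d = λ p → if does (p ≟ˢ q) then [ e ] else d s p }

  -- A loop either runs to its normal exit or executes `return`.
  data Outcome : Set where
    continue : Store → Outcome
    return   : List ℕ → Outcome

  -- The loops are given by big-step semantics, so a derivation is a terminating run.

  -- StackLinks s i k q k′: while POS[q] = i, started with the values k and q,
  -- ends with the value k′ of k.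
  data StackLinks (s : Store) (i : ℕ) : ℕ → State → ℕ → Set where
    exit  : ∀ {k q} → POS q ≢ i → StackLinks s i k q k
    raise : ∀ {k q k′} → POS q ≡ i → [ ℓ q ] ≤⁺ d s q →
            StackLinks s i (k ⊔ (i ∸ ℓ q + 1)) (F q) k′ → StackLinks s i k q k′
    skip  : ∀ {k q k′} → POS q ≡ i → ¬ ([ ℓ q ] ≤⁺ d s q) →
            StackLinks s i k (F q) k′ → StackLinks s i k q k′

  -- Stack s i k k′: while k ≤ i.
  data Stack (s : Store) : ℕ → ℕ → ℕ → Set where
    exit : ∀ {i k} → ¬ (k ≤ i) → Stack s i k k
    step : ∀ {i k k₁ k′} → k ≤ i → StackLinks s i k (T i) k₁ →
           Stack s (i ∸ 1) k₁ k′ → Stack s i k k′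

  -- UpdateLinks e q s o: while q ≠ I and e < d[q].
  data UpdateLinks (e : ℕ) : State → Store → Outcome → Set where
    exit  : ∀ {q s} → ¬ (q ≢ I × [ e ] <⁺ d s q) → UpdateLinks e q s (continue s)
    keep  : ∀ {q s o} → q ≢ I → [ e ] <⁺ d s q → let s₁ = s [d q ≔ e ] in
            ¬ (d s₁ q <⁺ [ ℓ q ]) →
            UpdateLinks e (F q) s₁ o → UpdateLinks e q s o
    check : ∀ {q s o} → q ≢ I → [ e ] <⁺ d s q → let s₁ = s [d q ≔ e ]; s₂ = s₁ ∪checked q in
            d s₁ q <⁺ [ ℓ q ] → card (checked s₂) ≢ size →
            UpdateLinks e (F q) s₂ o → UpdateLinks e q s o
    stop  : ∀ {q s} → q ≢ I → [ e ] <⁺ d s q → let s₁ = s [d q ≔ e ]; s₂ = s₁ ∪checked q in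
            d s₁ q <⁺ [ ℓ q ] → card (checked s₂) ≡ size →
            UpdateLinks e q s (return (P s₂))

  -- Update k j i s o: the remaining iterations i, i + 1, …, j of the loop
  -- for k, k + 1, …, j.
  data Update (k j : ℕ) : ℕ → Store → Outcome → Set where
    exit : ∀ {i s} → ¬ (i ≤ j) → Update k j i s (continue s)
    step : ∀ {i s s′ o} → i ≤ j → UpdateLinks (i ∸ k) (T i) s (continue s′) →
           Update k j (suc i) s′ o → Update k j i s o
    stop : ∀ {i s R} → i ≤ j → UpdateLinks (i ∸ k) (T i) s (return R) →
           Update k j i s (return R)

  -- Main j s o: while j > 0.
  data Main : ℕ → Store → Outcome → Set where
    exit : ∀ {j s} → ¬ (j > 0) → Main j s (continue s)
    step : ∀ {j k s s′ o} → j > 0 → Stack s j 1 k → Update k j k (s ∪P k) (continue s′) →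
           Main (k ∸ 1) s′ o → Main j s o
    stop : ∀ {j k s R} → j > 0 → Stack s j 1 k → Update k j k (s ∪P k) (return R) →
           Main j s (return R)

  -- The main loop is not entered for the empty word, so `return` cannot be
  -- executed; the output is then the value of P on leaving the loop. For a
  -- non-empty word, an output has to come from `return`.
  data GetAnAttractorOutputs : List ℕ → Set where
    returned : ∀ {R} → Main n initial (return R) → GetAnAttractorOutputs R
    empty    : ∀ {s} → w ≡ [] → Main n initial (continue s) → GetAnAttractorOutputs (P s)

{-# OPTIONS --safe #-}
module Submission where

-- Soundness: a state enters `checked` only when some ending position j of its
-- words has a point t ∈ P at distance j ∸ t < ℓ[q] to its left, so that the
-- occurrence ending at j of every word of q contains t. Once |S(w)| states are
-- checked, every non-empty factor is covered.
--
-- Termination by `return`: the suffix links from T[i] run through exactly the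
-- states having i as an ending position. Along them POS does not increase, so
-- stacking meets every state with POS[q] = i, and d never increases, so cutting
-- an update walk short at e ≥ d[q] leaves d ≤ e on the rest of the path. Hence the
-- k found by stacking makes d[q] < ℓ[q] for every q with k ≤ POS[q] ≤ j; if the
-- main loop reached j = 0, all states would be checked, which `return` had to
-- detect earlier.

open import Data.Bool using (if_then_else_)
open import Data.Empty using (⊥-elim)
open import Data.List using
  (List; []; _∷_; _++_; length; map; take; drop; filter; concatMap; upTo; applyUpTo; deduplicate)
open import Data.List.Extrema.Nat using (argmin-sel; argmin-all; min≤xs)
open import Data.List.Membership.Propositional using (_∈_; _∉_; lose; find)
open import Data.List.Membership.Propositional.Properties using
  (∈-∃++; ∈-++⁺ˡ; ∈-++⁺ʳ; ∈-++⁻; ∈-concatMap⁺; ∈-concatMap⁻; ∈-cartesianProductWith⁺;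
   ∈-cartesianProductWith⁻; ∈-applyUpTo⁺; ∈-applyUpTo⁻; ∈-upTo⁺; ∈-upTo⁻;
   ∈-filter⁺; ∈-filter⁻; ∈-map⁺; ∈-map⁻; ∈-deduplicate⁺; ∈-deduplicate⁻)
import Data.List.Membership.DecPropositional as DecMembership
import Data.List.Properties as List
open import Data.List.Relation.Binary.Subset.Propositional using (_⊆_)
open import Data.List.Relation.Unary.All using (All; []; _∷_)
import Data.List.Relation.Unary.All as All
import Data.List.Relation.Unary.All.Properties as All
open import Data.List.Relation.Unary.Any using (here; there)
open import Data.List.Relation.Unary.Unique.Propositional using (Unique; []; _∷_)
open import Data.List.Relation.Unary.Unique.DecPropositional.Properties using (deduplicate-!)
open import Data.Nat using
  (ℕ; zero; suc; _+_; _∸_; _≤_; _<_; z≤n; s≤s; s≤s⁻¹; _≤?_; _<?_; _≟_)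
open import Data.Nat.Induction using (<-wellFounded)
open import Data.Nat.Properties
open import Data.Product using (_×_; _,_; ∃; ∃₂; proj₁; proj₂)
open import Data.Sum using (_⊎_; inj₁; inj₂)
open import Defs
open import Function using (_∘_; id)
open import Induction.WellFounded using (Acc; acc)
import Relation.Binary.Construct.Add.Supremum.NonStrict _≤_ as ≤⁺
import Relation.Binary.Construct.Add.Supremum.Strict _<_ as <⁺
open import Relation.Binary.Definitions using (DecidableEquality)
open import Relation.Binary.PropositionalEquality
  using (_≡_; _≢_; refl; sym; trans; cong; subst)
open import Relation.Nullary using (¬_; Dec; yes; no; does; contradiction)
open import Relation.Nullary.Construct.Add.Supremum using (_⁺; [_]; ⊤⁺)
open import Relation.Nullary.Decidable using (dec-true; decidable-stable; ¬?; _×-dec_)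

open ≤⁺ using (_≤⁺_)
open <⁺ using (_<⁺_)

-- Suffixes of lists and counting in duplicate-free lists.

module _ {a} {A : Set a} where

  Suffix : List A → List A → Set a
  Suffix u v = ∃ λ p → v ≡ p ++ u

  Suffix-refl : ∀ {u} → Suffix u u
  Suffix-refl = [] , refl

  Suffix-trans : ∀ {u v x} → Suffix u v → Suffix v x → Suffix u x
  Suffix-trans (p , refl) (r , refl) = r ++ p , sym (List.++-assoc r p _)

  suffixes-comparable : ∀ {u v x : List A} → Suffix u x → Suffix v x → length u ≤ length v → Suffix u v
  suffixes-comparable (p , refl) ([] , refl) _ = p , refl
  suffixes-comparable {u} {v} ([] , refl) (y ∷ r , refl) u≤v =
    contradiction u≤v (<⇒≱ (s≤s (List.length-++-≤ʳ v {r})))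
  suffixes-comparable (x ∷ p , refl) (y ∷ r , eq) u≤v =
    suffixes-comparable (p , refl) (r , List.∷-injectiveʳ eq) u≤v

  drop-take : ∀ m k (xs : List A) → drop m (take k xs) ≡ take (k ∸ m) (drop m xs)
  drop-take zero    k       xs       = refl
  drop-take (suc m) zero    xs       = refl
  drop-take (suc m) (suc k) []       = sym (List.take-[] (k ∸ m))
  drop-take (suc m) (suc k) (x ∷ xs) = drop-take m k xs

  drop-length-++ : ∀ (xs ys : List A) → drop (length xs) (xs ++ ys) ≡ ys
  drop-length-++ []       ys = refl
  drop-length-++ (x ∷ xs) ys = drop-length-++ xs ys

  0<length : ∀ {xs : List A} → xs ≢ [] → 0 < length xs
  0<length {[]}    xs≢[] = contradiction refl xs≢[]
  0<length {_ ∷ _} _     = s≤s z≤n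

  Unique-⊆-length : ∀ {xs ys : List A} → Unique xs → xs ⊆ ys → length xs ≤ length ys
  Unique-⊆-length [] _ = z≤n
  Unique-⊆-length {x ∷ xs} (x∉xs ∷ xs!) xs⊆ys with ∈-∃++ (xs⊆ys (here refl))
  ... | as , bs , refl =
    subst (suc (length xs) ≤_) (sym (List.length-++-sucʳ as x bs)) (s≤s (Unique-⊆-length xs! xs⊆as++bs))
    where
    xs⊆as++bs : xs ⊆ as ++ bs
    xs⊆as++bs z∈xs with ∈-++⁻ as (xs⊆ys (there z∈xs))
    ... | inj₁ z∈as          = ∈-++⁺ˡ z∈as
    ... | inj₂ (here refl)   = contradiction refl (All.lookup x∉xs z∈xs)
    ... | inj₂ (there z∈bs)  = ∈-++⁺ʳ as z∈bs

  -- Pigeonhole: an element of `ys` missing from `xs` could be put in front of `xs`, giving a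
  -- duplicate-free list inside `ys` that is longer than `ys`.
  Unique-⊆-⊇ : DecidableEquality A → ∀ {xs ys : List A} →
    Unique xs → xs ⊆ ys → length ys ≤ length xs → ys ⊆ xs
  Unique-⊆-⊇ _≈?_ {xs} {ys} xs! xs⊆ys ys≤xs {y} y∈ys =
    decidable-stable (y ∈? xs) λ y∉xs →
      <⇒≱ (Unique-⊆-length (All.tabulate (λ { z∈xs refl → y∉xs z∈xs }) ∷ xs!)
            λ { (here refl) → y∈ys ; (there z∈xs) → xs⊆ys z∈xs })
          ys≤xs
    where open DecMembership _≈?_ using (_∈?_)

-- Arithmetic of positions and the order on extended naturals.

i∸l+1≤i : ∀ {i l} → 0 < i → 0 < l → i ∸ l + 1 ≤ i
i∸l+1≤i {suc i} {suc l} _ _ = ≤-trans (≤-reflexive (+-comm _ 1)) (s≤s (m∸n≤m i l))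

-- An interval of length `l` ending at `m` starts at `m ∸ l + 1`. This turns the bound obtained from
-- stacking into the condition `d[q] < ℓ[q]` for checking a state.
m∸l+1≤k⇒m∸k<l : ∀ {m k l} → 0 < l → 0 < k → k ≤ m → m ∸ l + 1 ≤ k → m ∸ k < l
m∸l+1≤k⇒m∸k<l {m} {k} {l} 0<l 0<k k≤m m∸l<k with l ≤? m
... | yes l≤m = +-cancelʳ-< k (m ∸ k) l (subst (_< l + k) (sym (m∸n+n≡m k≤m))
        (subst (_≤ l + k) eq (+-monoʳ-≤ l m∸l<k)))
  where
  eq : l + (m ∸ l + 1) ≡ suc m
  eq = trans (sym (+-assoc l (m ∸ l) 1)) (trans (cong (_+ 1) (m+[n∸m]≡n l≤m)) (+-comm m 1))
-- Here the truncated `m ∸ l` is 0, and `m ∸ k ≤ m < l` settles the claim.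
... | no l≰m = ≤-<-trans (m∸n≤m m k) (≰⇒> l≰m)

≰⁺⇒>⁺ : ∀ {m x} → ¬ ([ m ] ≤⁺ x) → x <⁺ [ m ]
≰⁺⇒>⁺ {x = [ _ ]} m≰x = <⁺.[ ≰⇒> (m≰x ∘ ≤⁺.[_]) ]
≰⁺⇒>⁺ {x = ⊤⁺}    m≰x = contradiction (_ ≤⁺.≤⊤⁺) m≰x

≮⁺⇒≥⁺ : ∀ {m x} → ¬ ([ m ] <⁺ x) → x ≤⁺ [ m ]
≮⁺⇒≥⁺ {x = [ _ ]} m≮x = ≤⁺.[ ≮⇒≥ (m≮x ∘ <⁺.[_]) ]
≮⁺⇒≥⁺ {x = ⊤⁺}    m≮x = contradiction <⁺.[ _ ]<⊤⁺ m≮x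

<⁺⇒≤⁺ : ∀ {x y} → x <⁺ y → x ≤⁺ y
<⁺⇒≤⁺ <⁺.[ x<y ]   = ≤⁺.[ <⇒≤ x<y ]
<⁺⇒≤⁺ <⁺.[ _ ]<⊤⁺ = _ ≤⁺.≤⊤⁺

≤⁺-refl : ∀ {x} → x ≤⁺ x
≤⁺-refl = ≤⁺.≤⁺-reflexive-≡ ≤-reflexive refl

≤⁺-trans : ∀ {x y z} → x ≤⁺ y → y ≤⁺ z → x ≤⁺ z
≤⁺-trans = ≤⁺.≤⁺-trans ≤-trans

≤⁺-<⁺-trans : ∀ {x y z} → x ≤⁺ y → y <⁺ z → x <⁺ z
≤⁺-<⁺-trans = <⁺.<⁺-transʳ ≤-<-trans

-- Ending positions and factors of a fixed word.

module _ {σ : ℕ} (w : Word σ) where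

  open DecMembership (_≟ʷ_ {σ}) using (_∈?_)

  -- Replaces `IsEndPos` by a form without a start position: `[]` needs no separate case, and
  -- passing to a suffix of `u` is transitivity of `Suffix`.
  Ends : Word σ → ℕ → Set
  Ends u j = j ≤ length w × Suffix u (take j w)

  Occurs : Word σ → Set
  Occurs u = ∃ λ j → Ends u j

  length-take-≤ : ∀ {j} → j ≤ length w → length (take j w) ≡ j
  length-take-≤ j≤n = trans (List.length-take _ w) (m≤n⇒m⊓n≡m j≤n)

  factor-drop : ∀ i j → factor w (suc i) j ≡ drop i (take j w)
  factor-drop i j = sym (drop-take i j w)

  Ends-factor : ∀ i {j} → j ≤ length w → Ends (factor w (suc i) j) j
  Ends-factor i {j} j≤n = j≤n , take i (take j w) ,
    sym (trans (cong (take i (take j w) ++_) (factor-drop i j)) (List.take++drop≡id i (take j w)))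

  Ends-[] : ∀ {j} → j ≤ length w → Ends [] j
  Ends-[] j≤n = j≤n , take _ w , sym (List.++-identityʳ _)

  Ends-0 : ∀ {u} → Ends u 0 → u ≡ []
  Ends-0 {u} (_ , p , eq) = List.++-conicalʳ p u (sym eq)

  Ends-suffix : ∀ {u v j} → Suffix v u → Ends u j → Ends v j
  Ends-suffix v⊑u (j≤n , u⊑w) = j≤n , Suffix-trans v⊑u u⊑w

  Ends-length : ∀ p u {j} → j ≤ length w → take j w ≡ p ++ u → length p + length u ≡ j
  Ends-length p u j≤n eq =
    trans (sym (List.length-++ p)) (trans (cong length (sym eq)) (length-take-≤ j≤n))

  suffix≡factor : ∀ {u j} p → take j w ≡ p ++ u → u ≡ factor w (suc (length p)) j
  suffix≡factor {u} {j} p eq = sym (trans (factor-drop (length p) j)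
    (trans (cong (drop (length p)) eq) (drop-length-++ p u)))

  -- The last component converts a bound on the distance from `t` to the ending position into a hit
  -- of the occurrence.
  Ends-occurrence : ∀ {u j} → u ≢ [] → Ends u j →
    ∃ λ i → IsOccurrence w u i j × (∀ t → j ∸ t < length u → i ≤ t)
  Ends-occurrence {[]} u≢[] _ = contradiction refl u≢[]
  Ends-occurrence {u@(_ ∷ _)} {j} _ (j≤n , p , eq) =
    suc (length p) , (s≤s z≤n , p<j , j≤n , suffix≡factor p eq) , covers
    where
    len : length p + length u ≡ j
    len = Ends-length p u j≤n eq
    p<j : length p < j
    p<j = subst (suc (length p) ≤_) len (≤-trans (≤-reflexive (+-comm 1 _)) (+-monoʳ-≤ (length p) (s≤s z≤n)))
    covers : ∀ t → j ∸ t < length u → length p < t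
    covers t j∸t<u = ≰⇒> λ t≤p → <⇒≱ j∸t<u
      (subst (_≤ j ∸ t) (trans (cong (_∸ length p) (sym len)) (m+n∸m≡n (length p) (length u)))
             (∸-monoʳ-≤ j t≤p))

  IsEndPos⇒Ends : ∀ {u j} → IsEndPos w u j → Ends u j
  IsEndPos⇒Ends {[]}    j≤n = Ends-[] j≤n
  IsEndPos⇒Ends {_ ∷ _} (suc i , _ , _ , j≤n , eq) =
    subst (λ v → Ends v _) (sym eq) (Ends-factor i j≤n)

  Ends⇒IsEndPos : ∀ {u j} → Ends u j → IsEndPos w u j
  Ends⇒IsEndPos {[]}    (j≤n , _) = j≤n
  Ends⇒IsEndPos {_ ∷ _} e with Ends-occurrence (λ ()) e
  ... | i , occ , _ = i , occ

  IsFactor⇒Occurs : ∀ {u} → IsFactor w u → Occurs u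
  IsFactor⇒Occurs (suc i , j , _ , j≤n , refl) = j , Ends-factor i j≤n

  ∈endPositions⁺ : ∀ {u j} → Ends u j → j ∈ endPositions w u
  ∈endPositions⁺ {u} e = ∈-filter⁺ (isEndPos? w u) (∈-upTo⁺ (s≤s (proj₁ e))) (Ends⇒IsEndPos e)

  ∈endPositions⁻ : ∀ {u j} → j ∈ endPositions w u → Ends u j
  ∈endPositions⁻ {u} j∈ =
    IsEndPos⇒Ends {u} (proj₂ (∈-filter⁻ (isEndPos? w u) {xs = upTo (suc (length w))} j∈))

  ∈factors⁺ : ∀ {u} → Occurs u → u ∈ factors w
  ∈factors⁺ {u} (j , j≤n , p , eq) = ∈-deduplicate⁺ _≟ʷ_
    (subst (_∈ _) (sym (suffix≡factor p eq))
      (∈-cartesianProductWith⁺ (factor w) (∈-applyUpTo⁺ suc (s≤s p≤n)) (∈-upTo⁺ (s≤s j≤n))))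
    where
    p≤n : length p ≤ length w
    p≤n = ≤-trans (subst (length p ≤_) (Ends-length p u j≤n eq) (m≤m+n _ _)) j≤n

  ∈factors⁻ : ∀ {u} → u ∈ factors w → Occurs u
  ∈factors⁻ u∈ with ∈-cartesianProductWith⁻ (factor w) (applyUpTo suc (suc (length w))) (upTo (suc (length w))) (∈-deduplicate⁻ _≟ʷ_ _ u∈)
  ... | _ , j , i∈ , j∈ , refl with ∈-applyUpTo⁻ suc i∈
  ... | i , _ , refl = j , Ends-factor i (s≤s⁻¹ (∈-upTo⁻ j∈))

  -- The order by ending positions, and states as classes.

  infix 4 _⊑_

  -- States are compared through representatives: on factors of `w` the symmetric part of this
  -- preorder is equality of states, and suffix links climb it.
  _⊑_ : Word σ → Word σ → Set
  u ⊑ v = ∀ {j} → Ends u j → Ends v j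

  Occurs-⊑ : ∀ {u v} → Occurs u → u ⊑ v → Occurs v
  Occurs-⊑ (j , e) u⊑v = j , u⊑v e

  ⊑-antisym : ∀ u v → u ⊑ v → v ⊑ u → endPositions w u ≡ endPositions w v
  ⊑-antisym u v u⊑v v⊑u = List.filter-≐ (isEndPos? w u) (isEndPos? w v)
    ( (λ {j} e → Ends⇒IsEndPos {v} (u⊑v (IsEndPos⇒Ends {u} e)))
    , (λ {j} e → Ends⇒IsEndPos {u} (v⊑u (IsEndPos⇒Ends {v} e))) )
    (upTo (suc (length w)))

  endPositions⇒⊑ : ∀ u v → endPositions w u ≡ endPositions w v → u ⊑ v
  endPositions⇒⊑ u v eq e = ∈endPositions⁻ {v} (subst (_ ∈_) eq (∈endPositions⁺ {u} e))

  -- Position 0 separates `[]` from every other word, hence `I` from every other state.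
  ends-at-0 : ∀ {u} → [] ⊑ u → u ≡ []
  ends-at-0 []⊑u = Ends-0 ([]⊑u (Ends-[] z≤n))

  shorter-suffix : ∀ {u v j} → Ends u j → Ends v j → length v ≤ length u → Suffix v u
  shorter-suffix (_ , u⊑) (_ , v⊑) = suffixes-comparable v⊑ u⊑

  -- At a common ending position one word is a suffix of the other; were `u` no longer than `v`, it
  -- would be a suffix of `v`, forcing `v ⊑ u`. Hence representatives shrink along links and link
  -- walks terminate.
  ⊏⇒shorter : ∀ {u v} → Occurs u → u ⊑ v → ¬ (v ⊑ u) → length v < length u
  ⊏⇒shorter (_ , e) u⊑v v⋢u = ≰⇒> λ u≤v → v⋢u (Ends-suffix (shorter-suffix (u⊑v e) e u≤v))

  ∈class⁺ : ∀ u {v} → Occurs v → endPositions w u ≡ endPositions w v → v ∈ class w u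
  ∈class⁺ u fv eq = ∈-filter⁺ (λ v → List.≡-dec _≟_ (endPositions w u) (endPositions w v)) (∈factors⁺ fv) eq

  ∈class⁻ : ∀ u {v} → v ∈ class w u → Occurs v × endPositions w u ≡ endPositions w v
  ∈class⁻ u v∈ with ∈-filter⁻ (λ v → List.≡-dec _≟_ (endPositions w u) (endPositions w v))
                                {xs = factors w} v∈
  ... | v∈factors , eq = ∈factors⁻ v∈factors , eq

  class-cong : ∀ u v → endPositions w u ≡ endPositions w v → class w u ≡ class w v
  class-cong u v eq =
    cong (λ ps → filter (λ v → List.≡-dec _≟_ ps (endPositions w v)) (factors w)) eq

  class-≡⁻ : ∀ u v → Occurs u → class w u ≡ class w v → endPositions w u ≡ endPositions w v
  class-≡⁻ u v fu eq = sym (proj₂ (∈class⁻ v (subst (u ∈_) eq (∈class⁺ u fu refl))))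

  class≡I : ∀ u → class w u ≡ I w → u ≡ []
  class≡I u eq = ends-at-0 (endPositions⇒⊑ [] u (class-≡⁻ [] u (0 , Ends-[] z≤n) (sym eq)))

  -- Suffix links.

  longestSuffixOutside-spec : ∀ q → [] ∉ q → ∀ x → let v = longestSuffixOutside w q x in
    v ∉ q × Suffix v x × (∀ {t} → t ∉ q → Suffix t x → Suffix t v)
  -- The search stops at `[]` at the latest, and `[] ∉ q` makes this a word outside `q`.
  longestSuffixOutside-spec q []∉q [] = []∉q , Suffix-refl , λ _ → id
  longestSuffixOutside-spec q []∉q x@(y ∷ x′) with x ∈? q
  ... | no x∉q  = x∉q , Suffix-refl , λ _ → id
  ... | yes x∈q with longestSuffixOutside-spec q []∉q x′
  ... | v∉q , v⊑x′ , longest = v∉q , Suffix-trans v⊑x′ (y ∷ [] , refl) , longest′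
    where
    longest′ : ∀ {t} → t ∉ q → Suffix t x → Suffix t (longestSuffixOutside w q x′)
    longest′ t∉q ([] , refl)    = contradiction x∈q t∉q
    longest′ t∉q (_ ∷ p , refl) = longest t∉q (p , refl)

  -- The suffix link of the state of u is the state of v, expressed by the
  -- order ⊑ on sets of ending positions: class v is the next state above class u.
  record Link (u v : Word σ) : Set where
    field
      F≡      : F w (class w u) ≡ class w v
      up      : u ⊑ v
      strict  : ¬ (v ⊑ u)
      covers  : ∀ {t} → u ⊑ t → class w t ≢ class w u → v ⊑ t

  -- `F` works on the head `x` of the class, which ends where `u` does. A word `t` above `u` in
  -- another state is a suffix of `x` outside the class, hence a suffix of the longest such word.
  link : ∀ {u} → Occurs u → u ≢ [] → ∃ (Link u)
  link {u} fu@(_ , ej) u≢[] with class w u in eq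
  ... | [] = contradiction (subst (u ∈_) eq (∈class⁺ u fu refl)) λ ()
  ... | x ∷ xs = v , record
      { F≡ = cong (F w) eq
      ; up = up
      ; strict = λ v⊑u → v∉q (subst (v ∈_) eq (∈class⁺ u (Occurs-⊑ fu up) (⊑-antisym u v up v⊑u)))
      ; covers = covers
      }
    where
    q : State w
    q = x ∷ xs
    []∉q : [] ∉ q
    []∉q []∈q = u≢[] (ends-at-0
      (endPositions⇒⊑ [] u (sym (proj₂ (∈class⁻ u (subst ([] ∈_) (sym eq) []∈q))))))
    v : Word σ
    v = longestSuffixOutside w q x
    spec = longestSuffixOutside-spec q []∉q x
    v∉q = proj₁ spec
    x-equiv : endPositions w u ≡ endPositions w x
    x-equiv = proj₂ (∈class⁻ u (subst (x ∈_) (sym eq) (here refl)))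
    up : u ⊑ v
    up = Ends-suffix (proj₁ (proj₂ spec)) ∘ endPositions⇒⊑ u x x-equiv
    covers : ∀ {t} → u ⊑ t → class w t ≢ class w u → v ⊑ t
    covers {t} u⊑t t≢u = Ends-suffix (proj₂ (proj₂ spec) t∉q (shorter-suffix (u⊑x ej) (u⊑t ej) t≤x))
      where
      u⊑x : u ⊑ x
      u⊑x = endPositions⇒⊑ u x x-equiv
      t∉q : t ∉ q
      t∉q t∈q = t≢u (class-cong t u (sym (proj₂ (∈class⁻ u (subst (t ∈_) (sym eq) t∈q)))))
      -- If `t` were longer, `x` would be a suffix of `t`, so `t ⊑ x ⊑ u` and `t` would lie in the
      -- state of `u`.
      t≤x : length t ≤ length x
      t≤x = ≮⇒≥ λ x<t → t≢u (class-cong t u (⊑-antisym t u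
        (endPositions⇒⊑ x u (sym x-equiv) ∘ Ends-suffix (shorter-suffix (u⊑t ej) (u⊑x ej) (<⇒≤ x<t)))
        u⊑t))

  -- `POS` and `ℓ` as minima over a state.

  POS-≤ : ∀ u {j} → Ends u j → POS w (class w u) ≤ j
  POS-≤ u {j} e = All.lookup (min≤xs (length w) _)
    (∈-concatMap⁺ (endPositions w) (lose (∈class⁺ u (j , e) refl) (∈endPositions⁺ {u} e)))

  Ends-POS : ∀ u → Occurs u → Ends u (POS w (class w u))
  Ends-POS u (j , e) with argmin-sel id (length w) (concatMap (endPositions w) (class w u))
  -- The default value `n` of `min` was selected; then `j ≤ n = POS ≤ j`, so `POS` is the ending
  -- position `j`.
  ... | inj₁ POS≡n = subst (Ends u) (≤-antisym j≤POS (POS-≤ u e)) e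
    where
    j≤POS : j ≤ POS w (class w u)
    j≤POS = subst (j ≤_) (sym POS≡n) (proj₁ e)
  ... | inj₂ POS∈ with find (∈-concatMap⁻ (endPositions w) POS∈)
  ... | v , v∈ , POS∈v =
    endPositions⇒⊑ v u (sym (proj₂ (∈class⁻ u v∈))) (∈endPositions⁻ {v} POS∈v)

  POS-≢[] : ∀ u {i} → 0 < i → POS w (class w u) ≡ i → u ≢ []
  POS-≢[] .[] 0<i POS≡i refl =
    <⇒≱ 0<i (subst (_≤ 0) POS≡i (POS-≤ [] (Ends-[] z≤n)))

  0<POS : ∀ u → Occurs u → u ≢ [] → 0 < POS w (class w u)
  0<POS u fu u≢[] = n≢0⇒n>0 λ POS≡0 → u≢[] (Ends-0 (subst (Ends u) POS≡0 (Ends-POS u fu)))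

  ℓ-≤ : ∀ u → Occurs u → ℓ w (class w u) ≤ length u
  ℓ-≤ u fu = All.lookup (min≤xs (length w) _) (∈-map⁺ length (∈class⁺ u fu refl))

  0<ℓ : ∀ u → Occurs u → u ≢ [] → 0 < ℓ w (class w u)
  0<ℓ u (j , e) u≢[] = argmin-all id {P = 0 <_} 0<n (All.map⁺ (All.tabulate λ {v} v∈ →
      0<length {xs = v} λ v≡[] → u≢[] (ends-at-0 (endPositions⇒⊑ [] u
        (sym (subst (λ x → endPositions w u ≡ endPositions w x) v≡[] (proj₂ (∈class⁻ u v∈))))))))
    where
    0<n : 0 < length w
    0<n = ≤-trans (n≢0⇒n>0 λ j≡0 → u≢[] (Ends-0 (subst (Ends u) j≡0 e))) (proj₁ e)

  -- The stacking phase.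

  Occurs-prefix : ∀ {i} → i ≤ length w → Occurs (factor w 1 i)
  Occurs-prefix i≤n = _ , Ends-factor 0 i≤n

  prefix-⊑ : ∀ {u i} → Ends u i → factor w 1 i ⊑ u
  prefix-⊑ (_ , u⊑) = Ends-suffix u⊑

  Link-shorter : ∀ {u v} → Occurs u → Link u v → length v < length u
  Link-shorter fu lk = ⊏⇒shorter fu (Link.up lk) (Link.strict lk)

  Link-Occurs : ∀ {u v} → Occurs u → Link u v → Occurs v
  Link-Occurs {u} {v} fu lk = Occurs-⊑ {u} {v} fu (Link.up lk)

  -- A state with `POS[q] = i > 0` is not `I`, so `ℓ[q] > 0` and raising cannot push `k` past `i`.
  -- The equation `q ≡ class w u` lets the induction on the run change representative at each link.
  StackLinks-bounds : ∀ {s i k q k′} → StackLinks w s i k q k′ → ∀ u → Occurs u → q ≡ class w u →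
    0 < i → k ≤ i → k ≤ k′ × k′ ≤ i
  StackLinks-bounds (exit _) u fu q≡u 0<i k≤i = ≤-refl , k≤i
  StackLinks-bounds {k = k} (raise POS≡i _ links) u fu refl 0<i k≤i =
    let u≢[] = POS-≢[] u 0<i POS≡i
        v , lk = link fu u≢[]
        k₁≤k′ , k′≤i = StackLinks-bounds links v (Link-Occurs fu lk) (Link.F≡ lk) 0<i
                         (⊔-lub k≤i (i∸l+1≤i 0<i (0<ℓ u fu u≢[])))
    in ≤-trans (m≤m⊔n k _) k₁≤k′ , k′≤i
  StackLinks-bounds (skip POS≡i _ links) u fu refl 0<i k≤i =
    let v , lk = link fu (POS-≢[] u 0<i POS≡i)
    in StackLinks-bounds links v (Link-Occurs fu lk) (Link.F≡ lk) 0<i k≤i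

  -- The target `v` stays above the current `u`, so the walk cannot stop before its state:
  -- `i = POS[v] ≤ POS[u] ≤ i`. There `k` is raised, and afterwards it never decreases.
  StackLinks-raises : ∀ {s i k q k′} → StackLinks w s i k q k′ → ∀ u → Ends u i → q ≡ class w u →
    0 < i → k ≤ i → ∀ v → u ⊑ v → POS w (class w v) ≡ i → [ ℓ w (class w v) ] ≤⁺ d s (class w v) →
    i ∸ ℓ w (class w v) + 1 ≤ k′
  StackLinks-raises {i = i} (exit POS≢i) u e refl _ _ v u⊑v POSv≡i _ =
    contradiction (≤-antisym (POS-≤ u e)
      (subst (_≤ POS w (class w u)) POSv≡i (POS-≤ v (u⊑v (Ends-POS u (i , e)))))) POS≢i
  StackLinks-raises {k = k} (raise POS≡i _ links) u e refl 0<i k≤i v u⊑v POSv≡i uncovered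
    = go (_≟ˢ_ w (class w v) (class w u))
    where
    u≢[] = POS-≢[] u 0<i POS≡i
    fu : Occurs u
    fu = _ , e
    lk = proj₂ (link fu u≢[])
    k₁≤i = ⊔-lub k≤i (i∸l+1≤i 0<i (0<ℓ u fu u≢[]))
    go : Dec (class w v ≡ class w u) → _
    go (yes v≡u) = subst (λ q → _ ∸ ℓ w q + 1 ≤ _) (sym v≡u)
      (≤-trans (m≤n⊔m k _)
        (proj₁ (StackLinks-bounds links _ (Link-Occurs fu lk) (Link.F≡ lk) 0<i k₁≤i)))
    go (no v≢u) = StackLinks-raises links _ (Link.up lk e) (Link.F≡ lk) 0<i k₁≤i v
      (Link.covers lk u⊑v v≢u) POSv≡i uncovered
  StackLinks-raises {s} (skip POS≡i covered links) u e refl 0<i k≤i v u⊑v POSv≡i uncovered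
    = StackLinks-raises links _ (Link.up lk e) (Link.F≡ lk) 0<i k≤i v
        (Link.covers lk u⊑v λ v≡u → covered (subst (λ q → [ ℓ w q ] ≤⁺ d s q) v≡u uncovered))
        POSv≡i uncovered
    where
    fu : Occurs u
    fu = _ , e
    lk = proj₂ (link fu (POS-≢[] u 0<i POS≡i))

  -- The upper bound is conditional because the recursive call may start with `k₁ = i`, already
  -- beyond its own `i ∸ 1`.
  Stack-bounds : ∀ {s i k k′} → Stack w s i k k′ → 0 < k → i ≤ length w → k ≤ k′ × (k ≤ i → k′ ≤ i)
  Stack-bounds (exit k≰i) _ _ = ≤-refl , λ k≤i → contradiction k≤i k≰i
  Stack-bounds {i = i} (step {k₁ = k₁} k≤i links stack) 0<k i≤n
    with StackLinks-bounds links _ (Occurs-prefix i≤n) refl (≤-trans 0<k k≤i) k≤i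
  ... | k≤k₁ , k₁≤i with Stack-bounds stack (≤-trans 0<k k≤k₁) (≤-trans (m∸n≤m i 1) i≤n)
  ... | k₁≤k′ , bound = ≤-trans k≤k₁ k₁≤k′ , λ _ → k′≤i stack bound
    where
    k′≤i : ∀ {k′} → Stack w _ (i ∸ 1) k₁ k′ → (k₁ ≤ i ∸ 1 → k′ ≤ i ∸ 1) → k′ ≤ i
    k′≤i (exit _) _ = k₁≤i
    k′≤i (step k₁≤i∸1 _ _) bound = ≤-trans (bound k₁≤i∸1) (m∸n≤m i 1)

  -- The descent of `i` goes on at least as far as the final `k′`, so it reaches `POS[v]`; the link
  -- walk from that prefix passes through the state of `v`.
  Stack-raises : ∀ {s i k k′} → Stack w s i k k′ → 0 < k → i ≤ length w →
    ∀ v → Occurs v → k′ ≤ POS w (class w v) → POS w (class w v) ≤ i →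
    [ ℓ w (class w v) ] ≤⁺ d s (class w v) → POS w (class w v) ∸ ℓ w (class w v) + 1 ≤ k′
  Stack-raises (exit k≰i) _ _ v fv k≤POS POS≤i _ = contradiction (≤-trans k≤POS POS≤i) k≰i
  Stack-raises {i = i} (step k≤i links stack) 0<k i≤n v fv k′≤POS POS≤i uncovered
    with StackLinks-bounds links _ (Occurs-prefix i≤n) refl (≤-trans 0<k k≤i) k≤i
       | POS w (class w v) ≟ i
  ... | k≤k₁ , k₁≤i | yes POS≡i =
    ≤-trans (subst (λ m → m ∸ ℓ w (class w v) + 1 ≤ _) (sym POS≡i)
        (StackLinks-raises links _ (Ends-factor 0 i≤n) refl (≤-trans 0<k k≤i) k≤i v
          (prefix-⊑ (subst (Ends v) POS≡i (Ends-POS v fv))) POS≡i uncovered))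
      (proj₁ (Stack-bounds stack (≤-trans 0<k k≤k₁) (≤-trans (m∸n≤m i 1) i≤n)))
  ... | k≤k₁ , k₁≤i | no POS≢i =
    Stack-raises stack (≤-trans 0<k k≤k₁) (≤-trans (m∸n≤m i 1) i≤n) v fv k′≤POS
      (∸-monoˡ-≤ 1 (≤∧≢⇒< POS≤i POS≢i)) uncovered

  -- Existence of terminating runs of the loops.

  StackLinks-total : ∀ s {i} → 0 < i → ∀ k {q} u → Occurs u → Acc _<_ (length u) → q ≡ class w u →
    ∃ (StackLinks w s i k q)
  StackLinks-total s {i} 0<i k u fu (acc rs) refl with POS w (class w u) ≟ i
  ... | no POS≢i = k , exit POS≢i
  ... | yes POS≡i = go (≤⁺.≤⁺-dec _≤?_ [ ℓ w (class w u) ] (d s (class w u)))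
    where
    lk = proj₂ (link fu (POS-≢[] u 0<i POS≡i))
    next : ∀ k → ∃ (StackLinks w s i k (F w (class w u)))
    next k = StackLinks-total s 0<i k _ (Link-Occurs fu lk) (rs (Link-shorter fu lk)) (Link.F≡ lk)
    go : Dec ([ ℓ w (class w u) ] ≤⁺ d s (class w u)) → ∃ (StackLinks w s i k (class w u))
    go (yes ℓ≤d) = _ , raise POS≡i ℓ≤d (proj₂ (next _))
    go (no ℓ≰d)  = _ , skip POS≡i ℓ≰d (proj₂ (next _))

  Stack-total : ∀ s i {k} → 0 < k → i ≤ length w → ∃ (Stack w s i k)
  Stack-total s zero    0<k _ = _ , exit (<⇒≱ 0<k)
  Stack-total s (suc i) {k} 0<k i<n with k ≤? suc i
  ... | no k≰i  = _ , exit k≰i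
  ... | yes k≤i with StackLinks-total s (s≤s z≤n) k _ (Occurs-prefix i<n) (<-wellFounded _) refl
  ... | k₁ , links with Stack-total s i
        (≤-trans 0<k (proj₁ (StackLinks-bounds links _ (Occurs-prefix i<n) refl (s≤s z≤n) k≤i))) (<⇒≤ i<n)
  ... | k′ , stack = k′ , step k≤i links stack

  UpdateLinks-total : ∀ e s {q} u → Occurs u → Acc _<_ (length u) → q ≡ class w u →
    ∃ (UpdateLinks w e q s)
  UpdateLinks-total e s u fu (acc rs) refl
    with (¬? (_≟ˢ_ w (class w u) (I w))) ×-dec <⁺.<⁺-dec _<?_ [ e ] (d s (class w u))
  ... | no ¬cond = _ , exit ¬cond
  ... | yes (q≢I , e<d) = go (<⁺.<⁺-dec _<?_ (d s₁ (class w u)) [ ℓ w (class w u) ])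
    where
    s₁ = _[d_≔_] w s (class w u) e
    s₂ = _∪checked_ w s₁ (class w u)
    lk = proj₂ (link fu (λ u≡[] → q≢I (cong (class w) u≡[])))
    next : ∀ s → ∃ (UpdateLinks w e (F w (class w u)) s)
    next s = UpdateLinks-total e s _ (Link-Occurs fu lk) (rs (Link-shorter fu lk)) (Link.F≡ lk)
    go : Dec (d s₁ (class w u) <⁺ [ ℓ w (class w u) ]) → ∃ (UpdateLinks w e (class w u) s)
    go (no d≮ℓ) = _ , keep q≢I e<d d≮ℓ (proj₂ (next _))
    go (yes d<ℓ) with card w (checked s₂) ≟ size w
    ... | yes all = _ , stop q≢I e<d d<ℓ all
    ... | no ¬all = _ , check q≢I e<d d<ℓ ¬all (proj₂ (next _))

  -- `m` bounds the number of remaining iterations, giving structural recursion while `i` counts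
  -- upwards.
  Update-total : ∀ {j} k → j ≤ length w → ∀ m i s → suc j ∸ i ≤ m → ∃ (Update w k j i s)
  Update-total {j} k j≤n m i s fuel with i ≤? j
  ... | no i≰j = _ , exit i≰j
  Update-total {j} k j≤n zero i s fuel | yes i≤j =
    contradiction (≤-trans (m<n⇒0<n∸m (s≤s i≤j)) fuel) λ ()
  Update-total {j} k j≤n (suc m) i s fuel | yes i≤j
    with UpdateLinks-total (i ∸ k) s _ (Occurs-prefix (≤-trans i≤j j≤n)) (<-wellFounded _) refl
  ... | return R , links = _ , stop i≤j links
  ... | continue s′ , links = _ , step i≤j links (proj₂ (Update-total k j≤n m (suc i) s′
    (s≤s⁻¹ (≤-trans (≤-reflexive (sym (+-∸-assoc 1 i≤j))) fuel))))

  Main-total : ∀ j → Acc _<_ j → j ≤ length w → ∀ s → ∃ (Main w j s)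
  Main-total zero    _        _   s = _ , exit λ ()
  Main-total (suc j) (acc rs) j<n s with Stack-total s (suc j) (s≤s z≤n) j<n
  ... | k , stack with Stack-bounds stack (s≤s z≤n) j<n
                     | Update-total k j<n _ k (_∪P_ w s k) ≤-refl
  ... | _ | return R , update = _ , stop (s≤s z≤n) stack update
  ... | 0<k , k≤ | continue s′ , update = _ , step (s≤s z≤n) stack update
    (proj₂ (Main-total (k ∸ 1) (rs k∸1≤j) (≤-trans (<⇒≤ k∸1≤j) j<n) s′))
    where
    k∸1≤j : k ∸ 1 < suc j
    k∸1≤j = s≤s (∸-monoˡ-≤ 1 (k≤ (s≤s z≤n)))

  -- Monotonicity of `d` along suffix links.

  lower : (State w → ℕ ⁺) → State w → ℕ → State w → ℕ ⁺
  lower D q e p = if does (_≟ˢ_ w p q) then [ e ] else D p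

  lower-≡ : ∀ D {q e p} → p ≡ q → lower D q e p ≡ [ e ]
  lower-≡ D {q} {e} {p} p≡q =
    cong (if_then [ e ] else D p) (dec-true (_≟ˢ_ w p q) p≡q)

  lower-≤ : ∀ D {q e} → [ e ] <⁺ D q → ∀ p → lower D q e p ≤⁺ D p
  lower-≤ D {q} e<D p with _≟ˢ_ w p q
  ... | yes refl = <⁺⇒≤⁺ e<D
  ... | no _     = ≤⁺-refl

  -- The state `I` is excluded as a target because the algorithm never writes `d` there, so its
  -- value stays infinite.
  Monotone : (State w → ℕ ⁺) → Set
  Monotone D = ∀ r q → Occurs r → r ⊑ q → q ≢ [] → D (class w q) ≤⁺ D (class w r)

  -- The state of d while a walk along suffix links, writing e, has reached p:
  -- monotonicity can fail only from states visited before p to p or beyond.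
  MonotoneUpTo : ℕ → Word σ → (State w → ℕ ⁺) → Set
  MonotoneUpTo e p D = ∀ r q → Occurs r → r ⊑ q → q ≢ [] →
    D (class w q) ≤⁺ D (class w r) ⊎ (p ⊑ q × ¬ (p ⊑ r) × [ e ] ≤⁺ D (class w r))

  -- New failures can arise only from `r` in the state of `p`, and by `covers` their `q` lies at
  -- `p′` or above. Old failures with `q` in the state of `p` are repaired, since the value there is
  -- now `e`; the others move up one link.
  MonotoneUpTo-lower : ∀ {e p p′ D} → Occurs p → Link p p′ → [ e ] <⁺ D (class w p) →
    MonotoneUpTo e p D → MonotoneUpTo e p′ (lower D (class w p) e)
  MonotoneUpTo-lower {e} {p} {p′} {D} fp lk e<D mono r q fr r⊑q q≢[]
    with _≟ˢ_ w (class w q) (class w p) | _≟ˢ_ w (class w r) (class w p)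
  ... | yes q≡p | yes r≡p = inj₁ ≤⁺-refl
  ... | yes q≡p | no r≢p  with mono r q fr r⊑q q≢[]
  ...   | inj₁ q≤r           = inj₁ (≤⁺-trans (<⁺⇒≤⁺ (subst (λ c → [ e ] <⁺ D c) (sym q≡p) e<D)) q≤r)
  ...   | inj₂ (_ , _ , e≤r) = inj₁ e≤r
  MonotoneUpTo-lower {e} {p} {p′} {D} fp lk e<D mono r q fr r⊑q q≢[] | no q≢p | yes r≡p =
    inj₂ ( Link.covers lk {q} (r⊑q ∘ endPositions⇒⊑ p r (sym r≈p)) q≢p
         , (λ p′⊑r → Link.strict lk (endPositions⇒⊑ r p r≈p ∘ p′⊑r))
         , ≤⁺-refl )
    where
    r≈p = class-≡⁻ r p fr r≡p
  MonotoneUpTo-lower {e} {p} {p′} {D} fp lk e<D mono r q fr r⊑q q≢[] | no q≢p | no r≢p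
    with mono r q fr r⊑q q≢[]
  ...   | inj₁ q≤r               = inj₁ q≤r
  ...   | inj₂ (p⊑q , p⋢r , e≤r) =
    inj₂ (Link.covers lk {q} p⊑q q≢p , (λ p′⊑r → p⋢r (p′⊑r ∘ Link.up lk)) , e≤r)

  -- Checked states and the attractor property.

  Covered : List ℕ → Word σ → Set
  Covered R u = ∃₂ λ t j → t ∈ R × Ends u j × t ≤ j × j ∸ t < ℓ w (class w u)

  CheckedState : List ℕ → State w → Set
  CheckedState R q = ∃ λ u → Occurs u × q ≡ class w u × (u ≡ [] ⊎ Covered R u)

  Positions : List ℕ → Set
  Positions = All (λ t → 1 ≤ t × t ≤ length w)

  checked-⊆-states : ∀ {R qs} → All (CheckedState R) qs →
    deduplicate (_≟ˢ_ w) qs ⊆ deduplicate (_≟ˢ_ w) (map (class w) (factors w))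
  checked-⊆-states {qs = qs} sound q∈ with All.lookup sound (∈-deduplicate⁻ (_≟ˢ_ w) qs q∈)
  ... | u , fu , refl , _ = ∈-deduplicate⁺ (_≟ˢ_ w) (∈-map⁺ (class w) (∈factors⁺ fu))

  -- Only states are checked, so equal cardinality means that all of them are. The state of `u` is
  -- then covered through some representative `v`, and `ℓ[q] ≤ |u|` carries the hit over to `u`.
  all-checked⇒attractor : ∀ {R qs} → Positions R → All (CheckedState R) qs →
    card w qs ≡ size w → IsAttractor w R
  all-checked⇒attractor {R} {qs} positions sound card≡size = positions , hits
    where
    hits : ∀ u → u ≢ [] → IsFactor w u →
      ∃₂ λ i j → IsOccurrence w u i j × ∃ λ t → t ∈ R × i ≤ t × t ≤ j
    hits u u≢[] u-factor with IsFactor⇒Occurs u-factor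
    ... | fu with All.lookup sound (∈-deduplicate⁻ (_≟ˢ_ w) qs
                    (Unique-⊆-⊇ (_≟ˢ_ w) (deduplicate-! (_≟ˢ_ w) qs) (checked-⊆-states sound)
                      (≤-reflexive (sym card≡size))
                      (∈-deduplicate⁺ (_≟ˢ_ w) (∈-map⁺ (class w) (∈factors⁺ fu)))))
    ... | v , fv , u≡v , inj₁ refl = contradiction (class≡I u u≡v) u≢[]
    ... | v , fv , u≡v , inj₂ (t , j , t∈R , ev , t≤j , j∸t<ℓ)
      with Ends-occurrence u≢[] (endPositions⇒⊑ v u (sym (class-≡⁻ u v fu u≡v)) ev)
    ... | i , occ , covers = i , j , occ , t , t∈R ,
      covers t (<-≤-trans (subst (λ q → j ∸ t < ℓ w q) (sym u≡v) j∸t<ℓ) (ℓ-≤ u fu)) , t≤j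

  -- Played against the field `unfinished` of the invariant: with every state checked, `return`
  -- would have been executed.
  all-states-checked : ∀ {R qs} → All (CheckedState R) qs →
    (∀ u → Occurs u → class w u ∈ qs) → card w qs ≡ size w
  all-states-checked {qs = qs} sound all = ≤-antisym
    (Unique-⊆-length (deduplicate-! (_≟ˢ_ w) qs) (checked-⊆-states sound))
    (Unique-⊆-length (deduplicate-! (_≟ˢ_ w) (map (class w) (factors w))) states-⊆)
    where
    states-⊆ : deduplicate (_≟ˢ_ w) (map (class w) (factors w)) ⊆ deduplicate (_≟ˢ_ w) qs
    states-⊆ q∈ with ∈-map⁻ (class w) (∈-deduplicate⁻ (_≟ˢ_ w) (map (class w) (factors w)) q∈)
    ... | u , u∈ , refl = ∈-deduplicate⁺ (_≟ˢ_ w) (all u (∈factors⁻ u∈))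

  -- The invariant and the updating phase.

  record Invariant (s : Store w) : Set where
    constructor invariant
    field
      positions  : Positions (P s)
      sound      : All (CheckedState (P s)) (checked s)
      -- The remaining fields together exclude a normal exit of the main loop. `I` has a field of
      -- its own because `d` is never lowered there.
      complete   : ∀ q → d s q <⁺ [ ℓ w q ] → q ∈ checked s
      I-checked  : I w ∈ checked s
      unfinished : card w (checked s) ≢ size w

  record Continues (s : Store w) (Q : Store w → Set) (s′ : Store w) : Set where
    constructor continues
    field
      inv   : Invariant s′
      mono  : Monotone (d s′)
      P≡    : P s′ ≡ P s
      d≤    : ∀ q → d s′ q ≤⁺ d s q
      post  : Q s′

  -- A Hoare-style postcondition in which a `return` must deliver the final result at once.
  Outcome-spec : Store w → (Store w → Set) → Outcome w → Set
  Outcome-spec s Q (continue s′) = Continues s Q s′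
  Outcome-spec s Q (return R)    = IsAttractor w R

  -- The sequencing rule: puts a step from `s` to `s₁` in front of a run already specified from
  -- `s₁`.
  Outcome-spec-map : ∀ {s s₁ Q Q₁} o → P s₁ ≡ P s → (∀ q → d s₁ q ≤⁺ d s q) →
    (∀ {s′} → (∀ q → d s′ q ≤⁺ d s₁ q) → Q₁ s′ → Q s′) → Outcome-spec s₁ Q₁ o → Outcome-spec s Q o
  Outcome-spec-map (continue s′) P≡ d≤ f (continues inv mono P′≡ d′≤ post) =
    continues inv mono (trans P′≡ P≡) (λ q → ≤⁺-trans (d′≤ q) (d≤ q)) (f d′≤ post)
  Outcome-spec-map (return R) _ _ _ attractor = attractor

  -- The state of `u` has just received `e` and is only lowered later; by `covers`, every other
  -- state above `u` lies above `v`.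
  lower-bound : ∀ {e u v D} {s′ : Store w} → Link u v →
    (∀ q → d s′ q ≤⁺ lower D (class w u) e q) →
    (∀ x → v ⊑ x → x ≢ [] → d s′ (class w x) ≤⁺ [ e ]) →
    ∀ x → u ⊑ x → x ≢ [] → d s′ (class w x) ≤⁺ [ e ]
  lower-bound {e} {u} {D = D} lk d′≤ above x u⊑x x≢[] with _≟ˢ_ w (class w x) (class w u)
  ... | yes x≡u = ≤⁺-trans (d′≤ _) (subst (_≤⁺ [ e ]) (sym (lower-≡ D x≡u)) ≤⁺-refl)
  ... | no  x≢u = above x (Link.covers lk {x} u⊑x x≢u) x≢[]

  newly-checked : ∀ D {R e u t j} → lower D (class w u) e (class w u) <⁺ [ ℓ w (class w u) ] →
    t ∈ R → Ends u j → t ≤ j → j ∸ t ≡ e → CheckedState R (class w u)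
  newly-checked D {u = u} {t} {j} d<ℓ t∈R ends t≤j refl =
    u , (j , ends) , refl , inj₂ (t , j , t∈R , ends , t≤j ,
      <⁺.[<]-injective (subst (_<⁺ _) (lower-≡ D {class w u} refl) d<ℓ))

  -- The witness `t`, `j` of distance `e` is kept along the whole walk, since an ending position of
  -- `u` is also one of its link target.
  UpdateLinks-spec : ∀ {e q s o} → UpdateLinks w e q s o → ∀ u → q ≡ class w u →
    Invariant s → MonotoneUpTo e u (d s) → (∃₂ λ t j → t ∈ P s × Ends u j × t ≤ j × j ∸ t ≡ e) →
    Outcome-spec s (λ s′ → ∀ v → u ⊑ v → v ≢ [] → d s′ (class w v) ≤⁺ [ e ]) o
  UpdateLinks-spec {e} {s = s} (exit ¬cond) u refl inv mono (_ , j , _ , ends , _) =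
    continues inv mono′ refl (λ _ → ≤⁺-refl) bound
    where
    d-u≤e : u ≢ [] → d s (class w u) ≤⁺ [ e ]
    d-u≤e u≢[] = ≮⁺⇒≥⁺ λ e<d → ¬cond ((u≢[] ∘ class≡I u) , e<d)
    nonempty : ∀ {v} → u ⊑ v → v ≢ [] → u ≢ []
    nonempty u⊑v v≢[] refl = v≢[] (ends-at-0 u⊑v)
    -- Taking `r = u` in `MonotoneUpTo`, the exceptional case would require `¬ (u ⊑ u)`. So
    -- `d[u] ≤ e`, the reason for stopping, spreads to everything above `u`; when `u` is `[]` there
    -- is no such non-empty `v`.
    bound : ∀ v → u ⊑ v → v ≢ [] → d s (class w v) ≤⁺ [ e ]
    bound v u⊑v v≢[] with mono u v (j , ends) u⊑v v≢[]
    ... | inj₁ v≤u           = ≤⁺-trans v≤u (d-u≤e (nonempty {v} u⊑v v≢[]))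
    ... | inj₂ (_ , u⋢u , _) = ⊥-elim (u⋢u id)
    -- The remaining exceptions have `q` above `u`, where `d[q] ≤ e ≤ d[r]` by `bound`.
    mono′ : Monotone (d s)
    mono′ r q fr r⊑q q≢[] with mono r q fr r⊑q q≢[]
    ... | inj₁ q≤r             = q≤r
    ... | inj₂ (u⊑q , _ , e≤r) = ≤⁺-trans (bound q u⊑q q≢[]) e≤r
  UpdateLinks-spec {e} {s = s} {o} (keep q≢I e<d d≮ℓ links) u refl
    (invariant positions sound complete I-checked unfinished) mono
    (t , j , t∈P , ends , t≤j , j∸t≡e) =
    Outcome-spec-map o refl (lower-≤ (d s) e<d) (λ {s′} → lower-bound {D = d s} {s′} lk)
      (UpdateLinks-spec links _ (Link.F≡ lk) inv₁
        (MonotoneUpTo-lower {D = d s} (j , ends) lk e<d mono) (t , j , t∈P , Link.up lk ends , t≤j , j∸t≡e))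
    where
    lk = proj₂ (link (j , ends) λ u≡[] → q≢I (cong (class w) u≡[]))
    s₁ = _[d_≔_] w s (class w u) e
    complete₁ : ∀ p → d s₁ p <⁺ [ ℓ w p ] → p ∈ checked s
    complete₁ p d<ℓ with _≟ˢ_ w p (class w u)
    ... | yes refl = contradiction (subst (_<⁺ _) (sym (lower-≡ (d s) {p} refl)) d<ℓ) d≮ℓ
    ... | no  _    = complete p d<ℓ
    inv₁ : Invariant s₁
    inv₁ = invariant positions sound complete₁ I-checked unfinished
  UpdateLinks-spec {e} {s = s} {o} (check q≢I e<d d<ℓ unfinished₂ links) u refl
    (invariant positions sound complete I-checked _) mono
    (t , j , t∈P , ends , t≤j , j∸t≡e) =
    Outcome-spec-map o refl (lower-≤ (d s) e<d) (λ {s′} → lower-bound {D = d s} {s′} lk)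
      (UpdateLinks-spec links _ (Link.F≡ lk) inv₂
        (MonotoneUpTo-lower {D = d s} (j , ends) lk e<d mono) (t , j , t∈P , Link.up lk ends , t≤j , j∸t≡e))
    where
    lk = proj₂ (link (j , ends) λ u≡[] → q≢I (cong (class w) u≡[]))
    s₂ = _∪checked_ w (_[d_≔_] w s (class w u) e) (class w u)
    complete₂ : ∀ p → d s₂ p <⁺ [ ℓ w p ] → p ∈ class w u ∷ checked s
    complete₂ p d<ℓ with _≟ˢ_ w p (class w u)
    ... | yes p≡q = here p≡q
    ... | no  _   = there (complete p d<ℓ)
    inv₂ : Invariant s₂
    inv₂ = invariant positions (newly-checked (d s) d<ℓ t∈P ends t≤j j∸t≡e ∷ sound)
             complete₂ (there I-checked) unfinished₂
  UpdateLinks-spec {s = s} (stop q≢I e<d d<ℓ finished) u refl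
    (invariant positions sound _ _ _) mono (t , j , t∈P , ends , t≤j , j∸t≡e) =
    all-checked⇒attractor positions (newly-checked (d s) d<ℓ t∈P ends t≤j j∸t≡e ∷ sound) finished

  -- Iteration `m` bounds `d` by `m ∸ k` on all states other than `I` with ending position `m`,
  -- these being above the prefix of length `m`; later iterations only lower `d`.
  Update-spec : ∀ {k j i s o} → Update w k j i s o → k ≤ i → j ≤ length w → k ∈ P s →
    Invariant s → Monotone (d s) →
    Outcome-spec s (λ s′ → ∀ v m → i ≤ m → m ≤ j → Ends v m → v ≢ [] →
                           d s′ (class w v) ≤⁺ [ m ∸ k ]) o
  Update-spec (exit i≰j) _ _ _ inv mono =
    continues inv mono refl (λ _ → ≤⁺-refl) λ v m i≤m m≤j → contradiction (≤-trans i≤m m≤j) i≰j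
  Update-spec {k} {i = i} (stop i≤j links) k≤i j≤n k∈P inv mono =
    UpdateLinks-spec links _ refl inv (λ r q fr r⊑q q≢[] → inj₁ (mono r q fr r⊑q q≢[]))
      (k , i , k∈P , Ends-factor 0 (≤-trans i≤j j≤n) , k≤i , refl)
  Update-spec {k} {j} {i} {o = o} (step {s′ = s₁} i≤j links update) k≤i j≤n k∈P inv mono
    with UpdateLinks-spec links _ refl inv (λ r q fr r⊑q q≢[] → inj₁ (mono r q fr r⊑q q≢[]))
           (k , i , k∈P , Ends-factor 0 (≤-trans i≤j j≤n) , k≤i , refl)
  ... | continues inv₁ mono₁ P≡ d≤ written =
    Outcome-spec-map o P≡ d≤ (λ {s′} → bound {s′})
      (Update-spec update (m≤n⇒m≤1+n k≤i) j≤n (subst (k ∈_) (sym P≡) k∈P) inv₁ mono₁)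
    where
    bound : ∀ {s′ : Store w} → (∀ q → d s′ q ≤⁺ d s₁ q) →
      (∀ v m → suc i ≤ m → m ≤ j → Ends v m → v ≢ [] → d s′ (class w v) ≤⁺ [ m ∸ k ]) →
      ∀ v m → i ≤ m → m ≤ j → Ends v m → v ≢ [] → d s′ (class w v) ≤⁺ [ m ∸ k ]
    bound d≤ later v m i≤m m≤j ends v≢[] with i ≟ m
    ... | yes refl = ≤⁺-trans (d≤ _) (written v (prefix-⊑ ends) v≢[])
    ... | no i≢m   = later v m (≤∧≢⇒< i≤m i≢m) m≤j ends v≢[]

  -- The main loop.

  CheckedState-∷ : ∀ {k R q} → CheckedState R q → CheckedState (k ∷ R) q
  CheckedState-∷ (u , fu , q≡u , inj₁ u≡[]) = u , fu , q≡u , inj₁ u≡[]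
  CheckedState-∷ (u , fu , q≡u , inj₂ (t , j , t∈R , rest)) =
    u , fu , q≡u , inj₂ (t , j , there t∈R , rest)

  Invariant-∪P : ∀ {k s} → 1 ≤ k → k ≤ length w → Invariant s → Invariant (_∪P_ w s k)
  Invariant-∪P 1≤k k≤n (invariant positions sound complete I-checked unfinished) =
    invariant ((1≤k , k≤n) ∷ positions) (All.map CheckedState-∷ sound) complete I-checked unfinished

  -- Progress of the main loop measured by `POS`: at `j = 0` this comprises every state except `I`.
  FinishedAbove : ℕ → (State w → ℕ ⁺) → Set
  FinishedAbove j D =
    ∀ v → Occurs v → j < POS w (class w v) → D (class w v) <⁺ [ ℓ w (class w v) ]

  -- A state with `POS` in the block that was unfinished forced `POS ∸ ℓ + 1 ≤ k` during stacking,
  -- and updating then left `d ≤ POS ∸ k < ℓ`. Finished states stay finished as `d` only decreases.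
  FinishedAbove-block : ∀ {s s′ : Store w} {k j} → Stack w s j 1 k → 0 < k → j ≤ length w →
    (∀ q → d s′ q ≤⁺ d s q) →
    (∀ v m → k ≤ m → m ≤ j → Ends v m → v ≢ [] → d s′ (class w v) ≤⁺ [ m ∸ k ]) →
    FinishedAbove j (d s) → FinishedAbove (k ∸ 1) (d s′)
  FinishedAbove-block {s} {k = suc k} {j} stack 0<k j≤n d≤ written above v fv k≤POS
    with j <? POS w (class w v) | <⁺.<⁺-dec _<?_ (d s (class w v)) [ ℓ w (class w v) ]
  ... | yes j<POS | _        = ≤⁺-<⁺-trans (d≤ _) (above v fv j<POS)
  ... | no j≮POS  | yes done = ≤⁺-<⁺-trans (d≤ _) done
  ... | no j≮POS  | no ¬done =
    ≤⁺-<⁺-trans (written v _ k≤POS (≮⇒≥ j≮POS) (Ends-POS v fv) v≢[])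
      <⁺.[ m∸l+1≤k⇒m∸k<l (0<ℓ v fv v≢[]) 0<k k≤POS
            (Stack-raises stack (s≤s z≤n) j≤n v fv k≤POS (≮⇒≥ j≮POS) uncovered) ]
    where
    v≢[] : v ≢ []
    v≢[] = POS-≢[] v (≤-trans (s≤s z≤n) k≤POS) refl
    uncovered : [ ℓ w (class w v) ] ≤⁺ d s (class w v)
    uncovered = decidable-stable (≤⁺.≤⁺-dec _≤?_ _ _) (¬done ∘ ≰⁺⇒>⁺)

  Main-spec : ∀ {j s o} → Main w j s o → j ≤ length w → Invariant s → Monotone (d s) →
    FinishedAbove j (d s) → ∃ λ R → o ≡ return R × IsAttractor w R
  Main-spec {zero} (exit _) _ (invariant _ sound complete I-checked unfinished) _ above =
    contradiction (all-states-checked sound all) unfinished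
    where
    all : ∀ u → Occurs u → class w u ∈ _
    all []         fu = I-checked
    all u@(_ ∷ _)  fu = complete _ (above u fu (0<POS u fu λ ()))
  Main-spec {suc j} (exit j≯0) _ _ _ _ = contradiction (s≤s z≤n) j≯0
  Main-spec {j} (stop j>0 stack update) j≤n inv mono above
    with Stack-bounds stack (s≤s z≤n) j≤n
  ... | 0<k , k≤ = _ , refl ,
    Update-spec update ≤-refl j≤n (here refl) (Invariant-∪P 0<k (≤-trans (k≤ j>0) j≤n) inv) mono
  Main-spec {j} {s} (step {s′ = s₁} j>0 stack update main) j≤n inv mono above
    with Stack-bounds stack (s≤s z≤n) j≤n
  ... | 0<k , k≤
    with Update-spec update ≤-refl j≤n (here refl) (Invariant-∪P 0<k (≤-trans (k≤ j>0) j≤n) inv) mono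
  ... | continues inv₁ mono₁ _ d≤ written =
    Main-spec main (≤-trans (m∸n≤m _ 1) (≤-trans (k≤ j>0) j≤n)) inv₁ mono₁
      (FinishedAbove-block {s} {s₁} stack 0<k j≤n d≤ written above)

  -- The initial store and the output.

  Invariant-initial : w ≢ [] → Invariant (initial w)
  Invariant-initial w≢[] = invariant [] (I-sound ∷ []) (λ _ ()) (here refl) unfinished
    where
    I-sound : CheckedState [] (I w)
    I-sound = [] , (0 , Ends-[] z≤n) , refl , inj₁ refl
    w-factor : Occurs w
    w-factor = length w , ≤-refl , [] , List.take-all (length w) w ≤-refl
    -- The non-empty word `w` is itself a factor outside `I`, so `I` is not the only state.
    unfinished : card w (I w ∷ []) ≢ size w
    unfinished card≡size with Unique-⊆-⊇ (_≟ˢ_ w) (deduplicate-! (_≟ˢ_ w) (I w ∷ []))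
      (checked-⊆-states (I-sound ∷ [])) (≤-reflexive (sym card≡size))
      (∈-deduplicate⁺ (_≟ˢ_ w) (∈-map⁺ (class w) (∈factors⁺ w-factor)))
    ... | here w≡I = w≢[] (class≡I w w≡I)

  Main-initial-spec : ∀ {o} → w ≢ [] → Main w (length w) (initial w) o →
    ∃ λ R → o ≡ return R × IsAttractor w R
  Main-initial-spec w≢[] main = Main-spec main ≤-refl (Invariant-initial w≢[]) (λ _ _ _ _ _ → ≤⁺-refl)
    λ v fv n<POS → contradiction (proj₁ (Ends-POS v fv)) (<⇒≱ n<POS)

  -- Totality provides a run with some outcome, and the specification of the main loop leaves only
  -- `return` of an attractor.
  nonempty-correct : w ≢ [] →
    ∃ (GetAnAttractorOutputs w) × (∀ R → GetAnAttractorOutputs w R → IsAttractor w R)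
  nonempty-correct w≢[] = run (Main-total (length w) (<-wellFounded _) ≤-refl (initial w)) , sound
    where
    run : ∃ (Main w (length w) (initial w)) → ∃ (GetAnAttractorOutputs w)
    run (o , main) with Main-initial-spec w≢[] main
    ... | R , refl , _ = R , returned main
    sound : ∀ R → GetAnAttractorOutputs w R → IsAttractor w R
    sound R (returned main) with Main-initial-spec w≢[] main
    ... | _ , refl , attractor = attractor
    sound _ (empty w≡[] _) = contradiction w≡[] w≢[]

proposition5 : ∀ (σ : ℕ) (w : Word σ) →
    (∃ λ (R : List ℕ) → GetAnAttractorOutputs w R) ×
    (∀ (R : List ℕ) → GetAnAttractorOutputs w R → IsAttractor w R)
proposition5 σ [] = ([] , empty refl (exit λ ())) , sound
  where
  sound : ∀ R → GetAnAttractorOutputs [] R → IsAttractor [] R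
  sound _ (returned (step () _ _ _))
  sound _ (returned (stop () _ _))
  sound _ (empty _ (step () _ _ _))
  sound _ (empty _ (exit _)) = [] , λ u u≢[] u-factor →
    contradiction (only-[] u-factor) u≢[]
    where
    only-[] : ∀ {u} → IsFactor [] u → u ≡ []
    only-[] (i , j , _ , _ , refl) =
      trans (cong (take (suc j ∸ i)) (List.drop-[] (i ∸ 1))) (List.take-[] (suc j ∸ i))
proposition5 σ w@(_ ∷ _) = nonempty-correct w λ ()
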